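{- The Maximum Disjoint $(2,2)$-Club Covering problem (on arbitrary input graphs) can be solved in linear time.
   Context: All graphs are finite, undirected and simple. For a graph $G=(V,E)$ and $V'\subseteq V$, $G[V']$ denotes the subgraph induced by $V'$. A set $V'\subseteq V$ is an $s$-club if $G[V']$ has diameter at most $s$, and a $(t,s)$-club is an $s$-club with at least $t$ vertices. For fixed $t,s$, the Maximum Disjoint $(t,s)$-Club Covering problem is the optimization problem: given a graph $G=(V,E)$, find a collection of pairwise vertex-disjoint $(t,s)$-clubs of $G$ that covers the maximum number of vertices of $V$. Linear time means time linear in the size $|V|+|E|$ of the input graph. -}

module Defs where

open import Data.Bool using (if_then_else_)
open import Data.Fin using (Fin; toℕ; _<?_)
open import Data.Fin.Subset using (Subset; _∈_; _∩_; ⋃; ∣_∣; Empty)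
open import Data.List using
  (List; []; _∷_; _∷ʳ_; length; map; concatMap; filter; cartesianProduct;
   allFin; tabulate; head; drop)
open import Data.List.Membership.Propositional using () renaming (_∈_ to _∈ˡ_)
open import Data.List.Relation.Unary.All using (All)
open import Data.List.Relation.Unary.AllPairs using (AllPairs)
open import Data.List.Relation.Unary.Unique.Propositional using (Unique)
open import Data.Maybe using (just; nothing)
open import Data.Nat using (ℕ; zero; suc; _+_; _*_; _∸_; _^_; _≤_; _≤?_; _≟_)
open import Data.Product using (Σ-syntax; ∃; ∃-syntax; _×_; _,_; proj₁)
open import Function using (_⇔_)
open import Level using (0ℓ)
open import Relation.Binary using (Rel; Decidable; Symmetric)
open import Relation.Binary.PropositionalEquality using (_≡_; _≢_)
open import Relation.Nullary using (¬_; does)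
open import Relation.Nullary.Decidable using (_×-dec_)

------------------------------------------------------------------------
-- Graphs

record Graph (V : Set) : Set₁ where
  field
    _~_    : Rel V 0ℓ
    _~?_   : Decidable _~_
    ~-sym  : Symmetric _~_
    ~-irr  : ∀ {v} → ¬ (v ~ v)

open Graph

_[_] : ∀ {n} → Graph (Fin n) → (S : Subset n) → Graph (∃[ v ] v ∈ S)
G [ S ] = record
  { _~_   = λ u v → _~_ G (proj₁ u) (proj₁ v)
  ; _~?_  = λ u v → _~?_ G (proj₁ u) (proj₁ v)
  ; ~-sym = ~-sym G
  ; ~-irr = ~-irr G
  }

edges : ∀ {n} → Graph (Fin n) → List (Fin n × Fin n)
edges {n} G =
  filter (λ (u , v) → (u <? v) ×-dec (_~?_ G u v))
         (cartesianProduct (allFin n) (allFin n))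

∣E_∣ : ∀ {n} → Graph (Fin n) → ℕ
∣E G ∣ = length (edges G)

data Walk {V : Set} (G : Graph V) : V → V → ℕ → Set where
  []  : ∀ {u} → Walk G u u 0
  _∷_ : ∀ {u v w k} → _~_ G u v → Walk G v w k → Walk G u w (suc k)

IsDistance : {V : Set} → Graph V → V → V → ℕ → Set
IsDistance G u v d = Walk G u v d × (∀ {k} → Walk G u v k → d ≤ k)

-- In a disconnected graph some pair of vertices has no distance, so no
-- bound on the diameter holds.
Diameter≤ : {V : Set} → Graph V → ℕ → Set
Diameter≤ G s = ∀ u v → ∃[ d ] IsDistance G u v d × d ≤ s

------------------------------------------------------------------------
-- Clubs and disjoint club coverings

Disjoint : ∀ {n} → Rel (Subset n) 0ℓ
Disjoint S T = Empty (S ∩ T)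

module _ {n : ℕ} (G : Graph (Fin n)) where

  IsClub : ℕ → Subset n → Set
  IsClub s S = Diameter≤ (G [ S ]) s

  IsTClub : ℕ → ℕ → Subset n → Set
  IsTClub t s S = IsClub s S × t ≤ ∣ S ∣

  IsDisjointClubCollection : ℕ → ℕ → List (Subset n) → Set
  IsDisjointClubCollection t s 𝒞 = All (IsTClub t s) 𝒞 × AllPairs Disjoint 𝒞

  IsMaximumCovering : ℕ → ℕ → List (Subset n) → Set
  IsMaximumCovering t s 𝒞 =
    IsDisjointClubCollection t s 𝒞 ×
    (∀ 𝒞′ → IsDisjointClubCollection t s 𝒞′ → ∣ ⋃ 𝒞′ ∣ ≤ ∣ ⋃ 𝒞 ∣)

-- A problem whose instances are graphs and whose answers are collections of
-- pairwise disjoint vertex sets, given by the correct answers.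
CollectionProblem : Set₁
CollectionProblem = ∀ {n} → Graph (Fin n) → List (Subset n) → Set

MaximumDisjointClubCovering : ℕ → ℕ → CollectionProblem
MaximumDisjointClubCovering t s G = IsMaximumCovering G t s

------------------------------------------------------------------------
-- The random access machine of Cook and Reckhow (over ℕ, with truncated
-- subtraction), under the uniform cost criterion.  Steps are only free of
-- hidden cost if cells have bounded size, so writing a value larger than
-- the word bound W crashes the machine.

Address Label : Set
Address = ℕ
Label   = ℕ

data Instruction : Set where
  const     : Address → ℕ → Instruction                  -- Xᵢ ← c
  add       : Address → Address → Address → Instruction  -- Xᵢ ← Xⱼ + Xₖ
  sub       : Address → Address → Address → Instruction  -- Xᵢ ← Xⱼ ∸ Xₖ
  load      : Address → Address → Instruction            -- Xᵢ ← X_{Xⱼ}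
  store     : Address → Address → Instruction            -- X_{Xᵢ} ← Xⱼ
  jump-if>0 : Label → Address → Instruction              -- goto l if Xⱼ > 0
  read      : Address → Instruction
  print     : Address → Instruction
  halt      : Instruction

Program : Set
Program = List Instruction

record State : Set where
  constructor state
  field
    pc     : Label
    memory : Address → ℕ
    input  : List ℕ
    output : List ℕ

data Outcome : Set where
  continue : State → Outcome
  halted   : List ℕ → Outcome
  crashed  : Outcome

_[_≔_] : (Address → ℕ) → Address → ℕ → Address → ℕ
(m [ a ≔ x ]) b = if does (a ≟ b) then x else m b

module _ (W : ℕ) where

  write : Address → ℕ → State → Outcome
  write a x (state pc m is os) =
    if does (x ≤? W)
    then continue (state (suc pc) (m [ a ≔ x ]) is os)
    else crashed

  execute : Instruction → State → Outcome
  execute (const i c)   s = write i c s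
  execute (add i j k)   s = write i (State.memory s j + State.memory s k) s
  execute (sub i j k)   s = write i (State.memory s j ∸ State.memory s k) s
  execute (load i j)    s = write i (State.memory s (State.memory s j)) s
  execute (store i j)   s = write (State.memory s i) (State.memory s j) s
  execute (jump-if>0 l j) (state pc m is os) with m j
  ... | zero  = continue (state (suc pc) m is os)
  ... | suc _ = continue (state l m is os)
  execute (read i)  (state pc m [] os)       = crashed
  execute (read i)  (state pc m (x ∷ is) os) = write i x (state pc m is os)
  execute (print i) (state pc m is os)       =
    continue (state (suc pc) m is (os ∷ʳ m i))
  execute halt      s                        = halted (State.output s)

  step : Program → State → Outcome
  step P s with head (drop (State.pc s) P)
  ... | just instr = execute instr s
  ... | nothing    = crashed

-- P , W ⊢ s ⇓[ t ] os: started in s, the program P halts after exactly t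
-- steps with output os.
data _,_⊢_⇓[_]_ (P : Program) (W : ℕ) : State → ℕ → List ℕ → Set where
  stop : ∀ {s os} → step W P s ≡ halted os → P , W ⊢ s ⇓[ 1 ] os
  next : ∀ {s s′ t os} → step W P s ≡ continue s′ →
         P , W ⊢ s′ ⇓[ t ] os → P , W ⊢ s ⇓[ suc t ] os

initial : List ℕ → State
initial is = state 0 (λ _ → 0) is []

------------------------------------------------------------------------
-- Input and output formats

-- The neighbours of each vertex may be listed in any order.
record AdjacencyLists {n : ℕ} (G : Graph (Fin n)) : Set where
  field
    neighbours : Fin n → List (Fin n)
    unique     : ∀ v → Unique (neighbours v)
    correct    : ∀ u v → v ∈ˡ neighbours u ⇔ _~_ G u v

-- The number of vertices, then for each vertex its degree followed by its
-- neighbours.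
encodeInput : ∀ {n} {G : Graph (Fin n)} → AdjacencyLists G → List ℕ
encodeInput {n} L = n ∷ concatMap encodeVertex (allFin n)
  where
  open AdjacencyLists L
  encodeVertex : Fin n → List ℕ
  encodeVertex v = length (neighbours v) ∷ map toℕ (neighbours v)

-- A collection of disjoint nonempty sets is output as one number per vertex,
-- in order: 0 if the vertex is not covered (the case u = v below), and
-- otherwise a name of the set containing it.
EncodesCollection : ∀ {n} → List ℕ → List (Subset n) → Set
EncodesCollection {n} os 𝒞 =
  Σ[ name ∈ (Fin n → ℕ) ]
    os ≡ tabulate name ×
    (∀ u v → (∃[ S ] S ∈ˡ 𝒞 × u ∈ S × v ∈ S) ⇔
             (name u ≡ name v × name u ≢ 0))

------------------------------------------------------------------------
-- Linear time

-- The word bound (2 + |V| + |E|) ^ w amounts to words of O(log (|V| + |E|))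
-- bits; the summand 1 in the time bound only matters for the empty graph.
SolvableInLinearTime : CollectionProblem → Set₁
SolvableInLinearTime Solution =
  Σ[ P ∈ Program ] Σ[ c ∈ ℕ ] Σ[ w ∈ ℕ ]
    (∀ n (G : Graph (Fin n)) (L : AdjacencyLists G) →
      ∃[ t ] ∃[ os ] ∃[ 𝒞 ]
        P , (2 + n + ∣E G ∣) ^ w ⊢ initial (encodeInput L) ⇓[ t ] os ×
        t ≤ c * (1 + n + ∣E G ∣) ×
        EncodesCollection os 𝒞 ×
        Solution G 𝒞)

{-# OPTIONS --safe #-}

-- A vertex lies in some (2,2)-club exactly when it is not isolated, so it is
-- enough to partition the non-isolated vertices into stars with at least two
-- vertices.  While the adjacency lists stream by, vertices are matched
-- greedily.  A vertex v that is still unmatched at the end of its list sees only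
-- matched vertices: it is attached to one of them, u, and u is marked.  From
-- then on no neighbour of v can be unmatched, so v never becomes the target of
-- an attachment.  The attached vertices of a marked u form a star around u.  If
-- exactly one end of a matching edge is marked, the other end joins its star; if
-- both are, the edge is dropped, and if none is, the edge is itself a star.
module Submission where

open import Defs
open import Data.Bool using (Bool; true; false)
open import Data.Fin using (Fin; zero; suc; toℕ; _<?_)
open import Data.Fin.Properties
  using (any?; injective⇒≤; toℕ-injective; toℕ<n; <-asym; <-cmp) renaming (_≟_ to _≟ᶠ_)
open import Data.Fin.Subset using (Subset; _∈_; _⊆_; ⋃; ⁅_⁆; ∣_∣)
open import Data.Fin.Subset.Properties
  using (∉⊥; x∈p∪q⁻; x∈p∪q⁺; x∈p∩q⁻; p⊆q⇒∣p∣≤∣q∣; x∈p⇒∣p-x∣<∣p∣;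
         x∈p∧x≢y⇒x∈p-y; x∈⁅x⁆; ∣⁅x⁆∣≡1)
open import Data.List using
  (List; []; _∷_; _++_; _∷ʳ_; length; lookup; map; foldl; filter; head; drop; concatMap;
   allFin; tabulate)
open import Data.List.Membership.Propositional using () renaming (_∈_ to _∈ˡ_)
open import Data.List.Membership.Propositional.Properties
  using (∈-map⁺; ∈-map⁻; ∈-filter⁺; ∈-allFin; ∈-lookup; ∈-concat⁻′; ∈-++⁺ˡ; ∈-++⁺ʳ;
         ∈-cartesianProduct⁺)
open import Data.List.Properties
  using (++-assoc; ++-identityʳ; map-tabulate; length-tabulate; length-++; length-map)
open import Data.List.Relation.Binary.Subset.Propositional using () renaming (_⊆_ to _⊆ˡ_)
open import Data.List.Relation.Unary.All as All using (All)
import Data.List.Relation.Unary.All.Properties as All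
open import Data.List.Relation.Unary.AllPairs as AllPairs using (_∷_)
import Data.List.Relation.Unary.AllPairs.Properties as AllPairs
open import Data.List.Relation.Unary.Any using (here; there; index)
open import Data.List.Relation.Unary.Any.Properties using (lookup-index)
open import Data.List.Relation.Unary.Unique.Propositional using (Unique)
import Data.List.Relation.Unary.Unique.Propositional.Properties as Unique
open import Data.Maybe using (Maybe; just; nothing; maybe)
open import Data.Maybe.Properties using (≡-dec; just-injective)
open import Data.Nat using
  (ℕ; zero; suc; _+_; _*_; _∸_; _^_; _≤_; _<_; _≤?_; _≟_; z≤n; s≤s)
import Data.Nat.Properties as ℕ
open import Data.Nat.Tactic.RingSolver using (solve-∀)
open import Data.Product using (∃-syntax; _×_; _,_; proj₁; proj₂; swap)
open import Data.Sum using (_⊎_; inj₁; inj₂)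
import Data.Vec as Vec
open import Data.Vec.Functional using (updateAt)
open import Data.Vec.Functional.Properties using (updateAt-updates; updateAt-minimal)
open import Data.Vec.Properties using ([]=⇒lookup; lookup⇒[]=; lookup∘tabulate)
open import Data.Vec.Properties.WithK using ([]=-irrelevant)
open import Function using (_∘_; mk⇔; Equivalence)
open import Relation.Binary using (DecidableEquality; tri<; tri≈; tri>)
open import Relation.Binary.PropositionalEquality
  using (_≡_; _≢_; refl; sym; trans; cong; cong₂; subst; ≢-sym)
open import Relation.Nullary using (¬_; Dec; yes; no; does; contradiction)
open import Relation.Nullary.Decidable using (dec-true; dec-false)

open Graph

-- Star partitions are maximum coverings

∈-⋃⁻ : ∀ {n} {x : Fin n} 𝒞 → x ∈ ⋃ 𝒞 → ∃[ S ] S ∈ˡ 𝒞 × x ∈ S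
∈-⋃⁻ []      x∈ = contradiction x∈ ∉⊥
∈-⋃⁻ (S ∷ 𝒞) x∈ with x∈p∪q⁻ S (⋃ 𝒞) x∈
... | inj₁ x∈S = S , here refl , x∈S
... | inj₂ x∈⋃ with T , T∈𝒞 , x∈T ← ∈-⋃⁻ 𝒞 x∈⋃ = T , there T∈𝒞 , x∈T

∈-⋃⁺ : ∀ {n} {x : Fin n} {S 𝒞} → S ∈ˡ 𝒞 → x ∈ S → x ∈ ⋃ 𝒞
∈-⋃⁺ (here refl)  x∈S = x∈p∪q⁺ (inj₁ x∈S)
∈-⋃⁺ (there S∈𝒞) x∈S = x∈p∪q⁺ (inj₂ (∈-⋃⁺ S∈𝒞 x∈S))

two-elements : ∀ {n} {x y : Fin n} {S} → x ∈ S → y ∈ S → y ≢ x → 2 ≤ ∣ S ∣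
two-elements x∈S y∈S y≢x =
  ℕ.≤-trans (s≤s (ℕ.≤-trans (s≤s z≤n) (x∈p⇒∣p-x∣<∣p∣ (x∈p∧x≢y⇒x∈p-y y∈S y≢x))))
            (x∈p⇒∣p-x∣<∣p∣ x∈S)

module _ {V : Set} (H : Graph V) (_≟_ : DecidableEquality V) where

  -- `IsDistance` asks for a shortest walk, so equal and adjacent pairs are settled first. For the
  -- remaining pairs any walk of length 2 is shortest.
  distance≤2 : ∀ {u v} → (u ≢ v → ¬ _~_ H u v → Walk H u v 2) →
               ∃[ d ] IsDistance H u v d × d ≤ 2
  distance≤2 {u} {v} walk with u ≟ v | _~?_ H u v
  ... | yes refl | _       = 0 , ([] , λ _ → z≤n) , z≤n
  ... | no u≢v   | yes u~v = 1 , (u~v ∷ [] , 1≤) , s≤s z≤n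
    where
    1≤ : ∀ {k} → Walk H u v k → 1 ≤ k
    1≤ []      = contradiction refl u≢v
    1≤ (_ ∷ _) = s≤s z≤n
  ... | no u≢v   | no ¬u~v = 2 , (walk u≢v ¬u~v , 2≤) , ℕ.≤-refl
    where
    2≤ : ∀ {k} → Walk H u v k → 2 ≤ k
    2≤ []            = contradiction refl u≢v
    2≤ (u~v ∷ [])    = contradiction u~v ¬u~v
    2≤ (_ ∷ (_ ∷ _)) = s≤s (s≤s z≤n)

∈-≟ : ∀ {n} {S : Subset n} → DecidableEquality (∃[ v ] v ∈ S)
∈-≟ (u , u∈S) (v , v∈S) with u ≟ᶠ v
... | no u≢v   = no (u≢v ∘ cong proj₁)
... | yes refl = yes (cong (u ,_) ([]=-irrelevant u∈S v∈S))

-- If `v` were isolated, every walk from `v` would be empty, so finite distances would force `S`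
-- into the singleton of `v`. This bounds every competing collection: it covers no isolated vertex.
club-neighbour : ∀ {n} (G : Graph (Fin n)) {t s} {S v} →
                 IsTClub G (suc (suc t)) s S → v ∈ S → ∃[ u ] _~_ G v u
club-neighbour G {S = S} {v} (club , 2≤∣S∣) v∈S with any? (_~?_ G v)
... | yes neighbour = neighbour
... | no isolated   = contradiction
  (subst (_ ≤_) (∣⁅x⁆∣≡1 v) (ℕ.≤-trans 2≤∣S∣ (p⊆q⇒∣p∣≤∣q∣ S⊆⁅v⁆)))
  (ℕ.<⇒≱ (s≤s (s≤s z≤n)))
  where
  S⊆⁅v⁆ : S ⊆ ⁅ v ⁆
  S⊆⁅v⁆ {u} u∈S with club (v , v∈S) (u , u∈S)
  ... | _ , ([] , _)        , _ = x∈⁅x⁆ v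
  ... | _ , ((v~w ∷ _) , _) , _ = contradiction (_ , v~w) isolated

module _ {n : ℕ} (G : Graph (Fin n)) where

  -- Taking the stars as the fibres of a partial map makes them disjoint by construction. `spanning`
  -- is the source of maximality.
  record IsStarPartition (center : Fin n → Maybe (Fin n)) : Set where
    field
      own        : ∀ {v c} → center v ≡ just c → center c ≡ just c
      adjacent   : ∀ {v c} → center v ≡ just c → v ≢ c → _~_ G v c
      nontrivial : ∀ {v c} → center v ≡ just c → ∃[ w ] w ≢ v × center w ≡ just c
      spanning   : ∀ {v u} → _~_ G v u → center v ≢ nothing

  module _ {center : Fin n → Maybe (Fin n)} (partition : IsStarPartition center) where
    open IsStarPartition partition

    _in?_ : ∀ v c → Dec (center v ≡ just c)
    v in? c = ≡-dec _≟ᶠ_ (center v) (just c)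

    star : Fin n → Subset n
    star c = Vec.tabulate λ v → does (v in? c)

    ∈-star⁺ : ∀ {v c} → center v ≡ just c → v ∈ star c
    ∈-star⁺ {v} {c} eq =
      lookup⇒[]= v _ (trans (lookup∘tabulate _ v) (dec-true (v in? c) eq))

    ∈-star⁻ : ∀ {v c} → v ∈ star c → center v ≡ just c
    ∈-star⁻ {v} {c} v∈ with v in? c | trans (sym (lookup∘tabulate _ v)) ([]=⇒lookup v∈)
    ... | yes eq | _ = eq

    star-club : ∀ {c} → center c ≡ just c → IsTClub G 2 2 (star c)
    star-club {c} eq = club , two-elements (∈-star⁺ eq) (∈-star⁺ w-in-c) w≢c
      where
      w-in-c = proj₂ (proj₂ (nontrivial eq))
      w≢c    = proj₁ (proj₂ (nontrivial eq))

      club : IsClub G 2 (star c)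
      club (u , u∈) (v , v∈) = distance≤2 (G [ star c ]) ∈-≟ via-center
        where
        via-center : (u , u∈) ≢ (v , v∈) → ¬ _~_ G u v →
                     Walk (G [ star c ]) (u , u∈) (v , v∈) 2
        via-center u≢v ¬u~v = _∷_ {v = c , ∈-star⁺ eq} u~c (c~v ∷ [])
          where
          -- The center is adjacent to every other member of its star, so neither of two distinct
          -- nonadjacent members can be the center.
          u≢c : u ≢ c
          u≢c refl = ¬u~v (~-sym G (adjacent (∈-star⁻ v∈)
            λ { refl → u≢v (cong (u ,_) ([]=-irrelevant _ _)) }))
          v≢c : v ≢ c
          v≢c refl = ¬u~v (adjacent (∈-star⁻ u∈) u≢c)
          u~c = adjacent (∈-star⁻ u∈) u≢c
          c~v = ~-sym G (adjacent (∈-star⁻ v∈) v≢c)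

    centers : List (Fin n)
    centers = filter (λ c → c in? c) (allFin n)

    stars : List (Subset n)
    stars = map star centers

    ∈-stars : ∀ {v c} → center v ≡ just c → star c ∈ˡ stars
    ∈-stars {c = c} eq = ∈-map⁺ star (∈-filter⁺ _ (∈-allFin c) (own eq))

    -- Maximality holds by inclusion, not by counting: each vertex of a competing club has a
    -- neighbour, hence lies in a star by `spanning`.
    stars-maximum : IsMaximumCovering G 2 2 stars
    stars-maximum =
      ( All.map⁺ (All.map star-club (All.all-filter _ (allFin n)))
      , AllPairs.map⁺ (AllPairs.map disjoint (AllPairs.filter⁺ _ (Unique.allFin⁺ n)))) ,
      λ 𝒞 (clubs , _) → p⊆q⇒∣p∣≤∣q∣ (covered 𝒞 clubs)
      where
      disjoint : ∀ {c d} → c ≢ d → Disjoint (star c) (star d)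
      disjoint c≢d (v , v∈) with v∈c , v∈d ← x∈p∩q⁻ _ _ v∈ =
        c≢d (just-injective (trans (sym (∈-star⁻ v∈c)) (∈-star⁻ v∈d)))

      covered : ∀ 𝒞 → All (IsTClub G 2 2) 𝒞 → ⋃ 𝒞 ⊆ ⋃ stars
      covered 𝒞 clubs {v} v∈ with S , S∈𝒞 , v∈S ← ∈-⋃⁻ 𝒞 v∈ with center v in eq
      ... | just c  = ∈-⋃⁺ (∈-stars eq) (∈-star⁺ eq)
      ... | nothing =
        contradiction eq (spanning (proj₂ (club-neighbour G (All.lookup clubs S∈𝒞) v∈S)))

    module _ (code : Fin n → ℕ) (code≢0 : ∀ {c} → code c ≢ 0)
             (code-injective : ∀ {c d} → code c ≡ code d → c ≡ d) where

      -- Names are kept abstract because the machine prints the handle of a center. Handles are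
      -- injective and never 0, the value reserved for uncovered vertices.
      stars-encoded : EncodesCollection (tabulate (maybe code 0 ∘ center)) stars
      stars-encoded = _ , refl , λ u v → mk⇔ (to u v) (from u v)
        where
        name : Fin n → ℕ
        name = maybe code 0 ∘ center

        to : ∀ u v → (∃[ S ] S ∈ˡ stars × u ∈ S × v ∈ S) → name u ≡ name v × name u ≢ 0
        to u v (S , S∈ , u∈S , v∈S) with c , _ , refl ← ∈-map⁻ star S∈
          rewrite ∈-star⁻ {u} u∈S | ∈-star⁻ {v} v∈S = refl , code≢0

        from : ∀ u v → name u ≡ name v × name u ≢ 0 → ∃[ S ] S ∈ˡ stars × u ∈ S × v ∈ S
        from u v (same , nonzero) with center u in equ | center v in eqv
        ... | nothing | _       = contradiction refl nonzero
        ... | just c  | nothing = contradiction same code≢0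
        ... | just c  | just d with refl ← code-injective same =
          star c , ∈-stars equ , ∈-star⁺ equ , ∈-star⁺ eqv

-- The greedy star partition

_[_↦_] : ∀ {A : Set} {n} → (Fin n → A) → Fin n → A → Fin n → A
f [ i ↦ x ] = updateAt f i (λ _ → x)

↦-same : ∀ {A : Set} {n} (f : Fin n → A) i {x} → (f [ i ↦ x ]) i ≡ x
↦-same f i = updateAt-updates i f

↦-other : ∀ {A : Set} {n} (f : Fin n → A) {i j x} → j ≢ i → (f [ i ↦ x ]) j ≡ f j
↦-other f {i} {j} = updateAt-minimal j i f

-- The kind is a ghost annotation: neither the algorithm nor the memory layout branches on it. It
-- serves the correctness proof.
data Kind : Set where
  matched attached : Kind

data Status (n : ℕ) : Set where
  free  : Status n
  bound : Kind → Fin n → Status n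

record Config (n : ℕ) : Set where
  constructor config
  field
    status : Fin n → Status n
    marked : Fin n → Bool

module _ {n : ℕ} where

  -- Any neighbour would do as the target of an attachment. The last one listed is what register `U`
  -- still holds when the list has been read.
  latest : Maybe (Fin n) → List (Fin n) → Maybe (Fin n)
  latest = foldl λ _ → just

  visit : Fin n → (Fin n → Status n) → Fin n → Fin n → Status n
  visit v st u with st v | st u
  ... | free      | free      = (st [ v ↦ bound matched u ]) [ u ↦ bound matched v ]
  ... | free      | bound _ _ = st
  ... | bound _ _ | _         = st

  attach : Fin n → Config n → Maybe (Fin n) → Config n
  attach v c@(config st mk) u? with st v | u?
  ... | free      | just u  = config (st [ v ↦ bound attached u ]) (mk [ u ↦ true ])
  ... | free      | nothing = c
  ... | bound _ _ | _       = c

  scan : Fin n → List (Fin n) → Config n → Config n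
  scan v us (config st mk) =
    attach v (config (foldl (visit v) st us) mk) (latest nothing us)

  scanAll : (Fin n → List (Fin n)) → Config n → List (Fin n) → Config n
  scanAll neighbours = foldl λ c v → scan v (neighbours v) c

  unscanned : Config n
  unscanned = config (λ _ → free) (λ _ → false)

  -- The two ends of an unmarked edge decide separately and must agree, so the tie is broken towards
  -- the smaller index. An attached vertex is unmarked with a marked partner, so it falls under the
  -- second case.
  partnerCenter : (Fin n → Bool) → Fin n → Fin n → Fin n
  partnerCenter mk v u with mk v | mk u
  ... | true  | _     = v
  ... | false | true  = u
  ... | false | false with u <? v
  ...   | yes _ = u
  ...   | no  _ = v

  center : Config n → Fin n → Maybe (Fin n)
  center (config st mk) v with st v
  ... | free      = nothing
  ... | bound _ u = just (partnerCenter mk v u)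

  latest-∈ : ∀ us {u₀ u} → latest u₀ us ≡ just u → u₀ ≡ just u ⊎ u ∈ˡ us
  latest-∈ []       eq = inj₁ eq
  latest-∈ (x ∷ us) eq with latest-∈ us eq
  ... | inj₁ refl = inj₂ (here refl)
  ... | inj₂ u∈us = inj₂ (there u∈us)

  latest-∷ : ∀ us {x} → latest (just x) us ≢ nothing
  latest-∷ (_ ∷ us) = latest-∷ us

  latest-nonempty : ∀ {us u₀ u} → u ∈ˡ us → latest u₀ us ≢ nothing
  latest-nonempty {_ ∷ us} _ = latest-∷ us

  infix 4 _⊑_
  -- The persistence order: the algorithm binds free vertices and never rewrites a bound status.
  _⊑_ : (st st′ : Fin n → Status n) → Set
  st ⊑ st′ = ∀ v {k u} → st v ≡ bound k u → st′ v ≡ bound k u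

  ⊑-bound : ∀ {st st′} → st ⊑ st′ → ∀ v → st v ≢ free → st′ v ≢ free
  ⊑-bound {st} ext v nf with st v in eq
  ... | free      = contradiction refl nf
  ... | bound _ _ = λ eq′ → contradiction (trans (sym (ext v eq)) eq′) λ ()

  update-⊑ : ∀ (st : Fin n → Status n) {v s} → st v ≡ free → st ⊑ st [ v ↦ s ]
  update-⊑ st {v} stv w stw =
    trans (↦-other st λ { refl → contradiction (trans (sym stv) stw) λ () }) stw

  visit-⊑ : ∀ v st u → st ⊑ visit v st u
  visit-⊑ v st u w eq with st v in stv | st u in stu
  ... | free      | bound _ _ = eq
  ... | bound _ _ | _         = eq
  ... | free      | free      =
    trans (↦-other _ (w≢ stu)) (trans (↦-other _ (w≢ stv)) eq)
    where
    w≢ : ∀ {x} → st x ≡ free → w ≢ x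
    w≢ stx refl = contradiction (trans (sym stx) eq) λ ()

  visits-⊑ : ∀ v us st → st ⊑ foldl (visit v) st us
  visits-⊑ v []       st w eq = eq
  visits-⊑ v (u ∷ us) st w eq = visits-⊑ v us (visit v st u) w (visit-⊑ v st u w eq)

  visit-nonfree : ∀ v st u → visit v st u v ≡ free → visit v st u u ≢ free
  visit-nonfree v st u eq with st v in stv | st u in stu
  ... | bound _ _ | _         = contradiction (trans (sym stv) eq) λ ()
  ... | free      | bound _ _ = λ stu′ → contradiction (trans (sym stu) stu′) λ ()
  ... | free      | free      = λ free′ → contradiction (trans (sym (↦-same _ u)) free′) λ ()

  -- Since bound statuses persist, a `v` that is free at the end was free just after visiting `u`.
  -- The visit would have matched the two had `u` been free, so `u` was bound then and stays bound.
  visits-nonfree : ∀ v us st → let st′ = foldl (visit v) st us in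
                   st′ v ≡ free → ∀ {u} → u ∈ˡ us → st′ u ≢ free
  visits-nonfree v (u ∷ us) st eq (there u∈) = visits-nonfree v us _ eq u∈
  visits-nonfree v (u ∷ us) st eq (here refl) =
    ⊑-bound (visits-⊑ v us (visit v st u)) u (visit-nonfree v st u v-free)
    where
    v-free : visit v st u v ≡ free
    v-free with visit v st u v in eq′
    ... | free      = refl
    ... | bound _ _ = contradiction (trans (sym (visits-⊑ v us _ v eq′)) eq) λ ()

-- The invariant of the greedy scan.

module _ {n : ℕ} (G : Graph (Fin n)) where

  -- `mark-used` makes the star of a marked vertex nontrivial and, as the vertex is matched, keeps
  -- it from being attached elsewhere. By `closed`, a free vertex has no attached neighbour, so
  -- attachments go only to matched vertices.
  record Invariant (c : Config n) : Set where
    open Config c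
    field
      matched-edge  : ∀ {v u} → status v ≡ bound matched u →
                      _~_ G v u × status u ≡ bound matched v
      attached-edge : ∀ {v u} → status v ≡ bound attached u →
                      _~_ G v u × marked u ≡ true
      mark-used     : ∀ {u} → marked u ≡ true →
                      (∃[ v ] status v ≡ bound attached u) × (∃[ w ] status u ≡ bound matched w)
      closed        : ∀ {v u} → status v ≡ bound attached u →
                      ∀ {w} → _~_ G v w → status w ≢ free

  open Invariant

  ~⇒≢ : ∀ {u v} → _~_ G u v → u ≢ v
  ~⇒≢ u~v refl = ~-irr G u~v

  unscanned-invariant : Invariant unscanned
  unscanned-invariant .matched-edge ()
  unscanned-invariant .attached-edge ()
  unscanned-invariant .mark-used ()
  unscanned-invariant .closed ()

  -- A visit creates only `matched` statuses, so every `attached` one is old, and all recorded facts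
  -- survive by `ext`.
  visit-invariant : ∀ {v u st mk} → _~_ G v u →
                    Invariant (config st mk) → Invariant (config (visit v st u) mk)
  visit-invariant {v} {u} {st} {mk} v~u inv with st v in stv | st u in stu | visit-⊑ v st u
  ... | bound _ _ | _         | _   = inv
  ... | free      | bound _ _ | _   = inv
  ... | free      | free      | ext = record
    { matched-edge  = matched-edge′
    ; attached-edge = attached-edge inv ∘ attached-old
    ; mark-used     = λ mku → let (w , stw) , (x , stx) = mark-used inv mku
                              in (w , ext w stw) , (x , ext _ stx)
    ; closed        = λ stw {x} w~x → ⊑-bound ext x (closed inv (attached-old stw) w~x)
    }
    where
    st′ = (st [ v ↦ bound matched u ]) [ u ↦ bound matched v ]

    st′v : st′ v ≡ bound matched u
    st′v = trans (↦-other _ (~⇒≢ v~u)) (↦-same st v)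

    st′u : st′ u ≡ bound matched v
    st′u = ↦-same _ u

    cases : ∀ w → (w ≡ v) ⊎ (w ≡ u) ⊎ (st′ w ≡ st w)
    cases w with w ≟ᶠ v | w ≟ᶠ u
    ... | yes w≡v | _       = inj₁ w≡v
    ... | no _    | yes w≡u = inj₂ (inj₁ w≡u)
    ... | no w≢v  | no w≢u  = inj₂ (inj₂ (trans (↦-other _ w≢u) (↦-other st w≢v)))

    matched-edge′ : ∀ {w x} → st′ w ≡ bound matched x →
                    _~_ G w x × st′ x ≡ bound matched w
    matched-edge′ {w} st′w with cases w
    ... | inj₁ refl with refl ← trans (sym st′v) st′w = v~u , st′u
    ... | inj₂ (inj₁ refl) with refl ← trans (sym st′u) st′w = ~-sym G v~u , st′v
    ... | inj₂ (inj₂ same) with w~x , stx ← matched-edge inv (trans (sym same) st′w) =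
      w~x , ext _ stx

    attached-old : ∀ {w x} → st′ w ≡ bound attached x → st w ≡ bound attached x
    attached-old {w} st′w with cases w
    ... | inj₁ refl        = contradiction (trans (sym st′v) st′w) λ ()
    ... | inj₂ (inj₁ refl) = contradiction (trans (sym st′u) st′w) λ ()
    ... | inj₂ (inj₂ same) = trans (sym same) st′w

  visits-invariant : ∀ {v mk} us st → (∀ {u} → u ∈ˡ us → _~_ G v u) →
                     Invariant (config st mk) →
                     Invariant (config (foldl (visit v) st us) mk)
  visits-invariant []       st v~ inv = inv
  visits-invariant (u ∷ us) st v~ inv =
    visits-invariant us _ (v~ ∘ there) (visit-invariant (v~ (here refl)) inv)

  module _ {v u st mk} (stv : st v ≡ free) (v~u : _~_ G v u)
           (saturated : ∀ {w} → _~_ G v w → st w ≢ free)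
           (inv : Invariant (config st mk)) where

    private
      st′ = st [ v ↦ bound attached u ]

      ext : st ⊑ st′
      ext = update-⊑ st stv

      old : ∀ {w s} → w ≢ v → st′ w ≡ s → st w ≡ s
      old w≢v = trans (sym (↦-other st w≢v))

      matched-edge′ : ∀ {w x} → st′ w ≡ bound matched x →
                      _~_ G w x × st′ x ≡ bound matched w
      matched-edge′ {w} eq with w ≟ᶠ v
      ... | yes refl = contradiction (trans (sym (↦-same st v)) eq) λ ()
      ... | no w≢v with w~x , stx ← matched-edge inv (old w≢v eq) = w~x , ext _ stx

      marks-kept : ∀ {x} → mk x ≡ true → (mk [ u ↦ true ]) x ≡ true
      marks-kept {x} mkx with x ≟ᶠ u
      ... | yes refl = ↦-same mk u
      ... | no x≢u   = trans (↦-other mk x≢u) mkx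

      attached-edge′ : ∀ {w x} → st′ w ≡ bound attached x →
                       _~_ G w x × (mk [ u ↦ true ]) x ≡ true
      attached-edge′ {w} eq with w ≟ᶠ v
      ... | yes refl with refl ← trans (sym (↦-same st v)) eq = v~u , ↦-same mk u
      ... | no w≢v with w~x , mkx ← attached-edge inv (old w≢v eq) = w~x , marks-kept mkx

      -- u is not attached, since its neighbour v is free.
      u-matched : ∃[ w ] st u ≡ bound matched w
      u-matched with st u in stu
      ... | free             = contradiction stu (saturated v~u)
      ... | bound matched w  = w , refl
      ... | bound attached w = contradiction stv (closed inv stu (~-sym G v~u))

      mark-used′ : ∀ {x} → (mk [ u ↦ true ]) x ≡ true →
                   (∃[ w ] st′ w ≡ bound attached x) × (∃[ w ] st′ x ≡ bound matched w)
      mark-used′ {x} mkx with x ≟ᶠ u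
      ... | yes refl = (v , ↦-same st v) , (proj₁ u-matched , ext u (proj₂ u-matched))
      ... | no x≢u
        with (w , stw) , (y , stx) ← mark-used inv (trans (sym (↦-other mk x≢u)) mkx) =
        (w , ext w stw) , (y , ext x stx)

      closed′ : ∀ {w x} → st′ w ≡ bound attached x → ∀ {y} → _~_ G w y → st′ y ≢ free
      closed′ {w} eq {y} w~y with w ≟ᶠ v
      ... | yes refl = ⊑-bound ext y (saturated w~y)
      ... | no w≢v   = ⊑-bound ext y (closed inv (old w≢v eq) w~y)

    -- Saturation of `v` supplies the new instance of `closed`, and `u-matched` justifies the new
    -- mark.
    attach-invariant : Invariant (config st′ (mk [ u ↦ true ]))
    attach-invariant = record
      { matched-edge  = matched-edge′
      ; attached-edge = attached-edge′
      ; mark-used     = mark-used′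
      ; closed        = closed′
      }

  module _ (L : AdjacencyLists G) where
    open AdjacencyLists L
    open Config

    private
      listed : ∀ {u v} → _~_ G u v → v ∈ˡ neighbours u
      listed = Equivalence.from (correct _ _)

      adjacent : ∀ {u v} → v ∈ˡ neighbours u → _~_ G u v
      adjacent = Equivalence.to (correct _ _)

    Progress : Fin n → Config n → Config n → Set
    Progress v c c′ =
      Invariant c′ × status c ⊑ status c′ × (∀ {u} → _~_ G v u → status c′ v ≢ free)

    -- If `v` is still free after the visits, all its neighbours are bound, which is the saturation
    -- that attaching requires. It stays free only when `latest` gives `nothing`, that is, when its
    -- list is empty.
    scan-progress : ∀ v c → Invariant c → Progress v c (scan v (neighbours v) c)
    scan-progress v (config st mk) inv
      with foldl (visit v) st (neighbours v)
         | visits-⊑ v (neighbours v) st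
         | visits-nonfree v (neighbours v) st
         | visits-invariant (neighbours v) st adjacent inv
    ... | st′ | ext | nonfree | inv′
      with st′ v in stv | latest nothing (neighbours v) in last
    ...   | bound _ _ | _ = inv′ , ext , λ _ eq → contradiction (trans (sym stv) eq) λ ()
    ...   | free | nothing =
      inv′ , ext , λ v~u → contradiction last (latest-nonempty (listed v~u))
    ...   | free | just u =
      attach-invariant stv (adjacent u∈) (nonfree refl ∘ listed) inv′ ,
      (λ w eq → update-⊑ st′ stv w (ext w eq)) ,
      λ _ eq → contradiction (trans (sym (↦-same st′ v)) eq) λ ()
      where
      u∈ : u ∈ˡ neighbours v
      u∈ with latest-∈ (neighbours v) last
      ... | inj₂ u∈us = u∈us

    scanAll-progress : ∀ vs c → Invariant c → let c′ = scanAll neighbours c vs in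
      Invariant c′ × status c ⊑ status c′ ×
      (∀ {v u} → v ∈ˡ vs → _~_ G v u → status c′ v ≢ free)
    scanAll-progress []       c inv = inv , (λ _ eq → eq) , λ ()
    scanAll-progress (v ∷ vs) c inv
      with inv₁ , ext₁ , settled₁ ← scan-progress v c inv
      with inv₂ , ext₂ , settled₂ ← scanAll-progress vs _ inv₁ =
      inv₂ , (λ w eq → ext₂ w (ext₁ w eq)) ,
      λ { (here refl) v~u → ⊑-bound ext₂ v (settled₁ v~u)
        ; (there v∈)  v~u → settled₂ v∈ v~u }

  -- From the invariant to a star partition.

  module _ {c : Config n} (inv : Invariant c)
           (settled : ∀ {v u} → _~_ G v u → Config.status c v ≢ free) where
    open Config c

    private
      bound-edge : ∀ {k v u} → status v ≡ bound k u → _~_ G v u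
      bound-edge {matched}  eq = proj₁ (matched-edge inv eq)
      bound-edge {attached} eq = proj₁ (attached-edge inv eq)

      -- A marked vertex is matched, which excludes being attached.
      unmarked : ∀ {v u} → status v ≡ bound attached u → marked v ≡ false
      unmarked {v} eq with marked v in mkv
      ... | false = refl
      ... | true with _ , (_ , eq′) ← mark-used inv mkv =
        contradiction (trans (sym eq) eq′) λ ()

      -- The reasons for a choice of center, with the evidence used by the partition.
      -- `partner-marked` covers attached vertices as well as matched ones whose partner alone is
      -- marked.
      data Role (v c′ : Fin n) : Set where
        marked-center : marked v ≡ true → c′ ≡ v → Role v c′
        partner-marked : ∀ {k u} → status v ≡ bound k u → marked u ≡ true → c′ ≡ u → Role v c′
        smaller : ∀ {u} → status v ≡ bound matched u →
                  center c u ≡ just c′ → c′ ≡ u ⊎ c′ ≡ v → Role v c′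

      center-marked : ∀ {v k u} → status v ≡ bound k u → marked v ≡ true →
                      center c v ≡ just v
      center-marked stv mkv rewrite stv | mkv = refl

      center-partner : ∀ {v k u} → status v ≡ bound k u → marked v ≡ false →
                       marked u ≡ true → center c v ≡ just u
      center-partner stv mkv mku rewrite stv | mkv | mku = refl

      -- Matching is mutual, so both ends compare the same two indices, and irreflexivity rules out
      -- a tie.
      center-symmetric : ∀ {v u} → status v ≡ bound matched u →
                         marked v ≡ false → marked u ≡ false → center c u ≡ center c v
      center-symmetric {v} {u} stv mkv mku
        with v~u , stu ← matched-edge inv stv
        rewrite stv | stu | mkv | mku with u <? v | v <? u
      ... | yes u<v | yes v<u = contradiction v<u (<-asym u<v)
      ... | yes _   | no _    = refl
      ... | no _    | yes _   = refl
      ... | no u≮v  | no v≮u with <-cmp u v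
      ...   | tri< u<v _ _ = contradiction u<v u≮v
      ...   | tri≈ _ u≡v _ = contradiction (sym u≡v) (~⇒≢ v~u)
      ...   | tri> _ _ v<u = contradiction v<u v≮u

      center-among : ∀ {v k u c′} → status v ≡ bound k u → center c v ≡ just c′ →
                     c′ ≡ u ⊎ c′ ≡ v
      center-among {v} {u = u} stv eq rewrite stv with marked v | marked u | eq
      ... | true  | _    | refl = inj₂ refl
      ... | false | true | refl = inj₁ refl
      ... | false | false | eq′ with u <? v | eq′
      ...   | yes _ | refl = inj₁ refl
      ...   | no _  | refl = inj₂ refl

      center-bound : ∀ {v c′} → center c v ≡ just c′ → ∃[ k ] ∃[ u ] status v ≡ bound k u
      center-bound {v} eq with status v
      ... | bound k u = k , u , refl

      role : ∀ {v c′} → center c v ≡ just c′ → Role v c′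
      role {v} eq with k , u , stv ← center-bound eq with marked v in mkv | marked u in mku
      ... | true  | _    =
        marked-center mkv (just-injective (trans (sym eq) (center-marked stv mkv)))
      ... | false | true =
        partner-marked stv mku (just-injective (trans (sym eq) (center-partner stv mkv mku)))
      ... | false | false with k
      ...   | attached =
        contradiction (trans (sym mku) (proj₂ (attached-edge inv stv))) λ ()
      ...   | matched =
        smaller stv (trans (center-symmetric stv mkv mku) eq) (center-among stv eq)

    center-partition : IsStarPartition G (center c)
    center-partition = record
      { own = own ; adjacent = adj ; nontrivial = nontrivial ; spanning = spanning }
      where
      own : ∀ {v c′} → center c v ≡ just c′ → center c c′ ≡ just c′
      own eq with role eq
      ... | marked-center _ refl = eq
      ... | partner-marked _ mku refl = center-marked (proj₂ (proj₂ (mark-used inv mku))) mku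
      ... | smaller _ eq′ (inj₁ refl) = eq′
      ... | smaller _ _ (inj₂ refl)   = eq

      adj : ∀ {v c′} → center c v ≡ just c′ → v ≢ c′ → _~_ G v c′
      adj eq v≢c with role eq
      ... | marked-center _ refl      = contradiction refl v≢c
      ... | partner-marked stv _ refl = bound-edge stv
      ... | smaller stv _ (inj₁ refl) = bound-edge stv
      ... | smaller _ _ (inj₂ refl)   = contradiction refl v≢c

      nontrivial : ∀ {v c′} → center c v ≡ just c′ → ∃[ w ] w ≢ v × center c w ≡ just c′
      -- The matching partner of a marked vertex may be marked itself and center another star. The
      -- second member is therefore an attached vertex, which is unmarked and so has `v` as its
      -- center.
      nontrivial eq with role eq
      ... | marked-center mkv refl with (w , stw) , _ ← mark-used inv mkv =
        w , ~⇒≢ (bound-edge stw) , center-partner stw (unmarked stw) mkv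
      ... | partner-marked {u = u} stv _ refl =
        u , ≢-sym (~⇒≢ (bound-edge stv)) , own eq
      ... | smaller {u} stv equ _ = u , ≢-sym (~⇒≢ (bound-edge stv)) , equ

      spanning : ∀ {v u} → _~_ G v u → center c v ≢ nothing
      spanning {v} v~u eq with status v in stv
      ... | free = contradiction stv (settled v~u)

  scanAll-partition : (L : AdjacencyLists G) →
    IsStarPartition G (center (scanAll (AdjacencyLists.neighbours L) unscanned (allFin n)))
  scanAll-partition L
    with inv , _ , settled ← scanAll-progress L (allFin n) unscanned unscanned-invariant =
    center-partition inv (settled (∈-allFin _))

-- Running programs

≔-same : ∀ m a {x} → (m [ a ≔ x ]) a ≡ x
≔-same m a rewrite dec-true (a ≟ a) refl = refl

≔-other : ∀ m {a b x} → a ≢ b → (m [ a ≔ x ]) b ≡ m b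
≔-other m {a} {b} a≢b rewrite dec-false (a ≟ b) a≢b = refl

module Execution (P : Program) (W : ℕ) where

  -- An upper bound replaces the exact step count, so that branches of different lengths can share
  -- one budget through `weaken`.
  Runs : State → ℕ → List ℕ → Set
  Runs s b out = ∃[ t ] (P , W ⊢ s ⇓[ t ] out × t ≤ b)

  weaken : ∀ {s out b} k → Runs s b out → Runs s (k + b) out
  weaken k (t , run , t≤b) = t , run , ℕ.≤-trans t≤b (ℕ.m≤n+m _ k)

  step-fetch : ∀ {i} s → head (drop (State.pc s) P) ≡ just i → step W P s ≡ execute W i s
  step-fetch s eq rewrite eq = refl

  module _ {pc : Label} {m : Address → ℕ} {is os : List ℕ} {b : ℕ} {out : List ℕ} where

    private
      At : Instruction → Set
      At i = head (drop pc P) ≡ just i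

      Here : Set
      Here = Runs (state pc m is os) (suc b) out

      After : Label → (Address → ℕ) → List ℕ → List ℕ → Set
      After pc′ m′ is′ os′ = Runs (state pc′ m′ is′ os′) b out

      continue-run : ∀ {i s′} → At i → execute W i (state pc m is os) ≡ continue s′ →
                     Runs s′ b out → Here
      continue-run at eq (t , run , t≤b) =
        suc t , next (trans (step-fetch _ at) eq) run , s≤s t≤b

      write-run : ∀ {i x is′} a → At i →
                  execute W i (state pc m is os) ≡ write W a x (state pc m is′ os) →
                  x ≤ W → After (suc pc) (m [ a ≔ x ]) is′ os → Here
      write-run {x = x} {is′} a at eq x≤W = continue-run at (trans eq written)
        where
        written : write W a x (state pc m is′ os) ≡ continue (state (suc pc) (m [ a ≔ x ]) is′ os)
        written rewrite dec-true (x ≤? W) x≤W = refl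

    run-const : ∀ {i c} → At (const i c) → c ≤ W →
                After (suc pc) (m [ i ≔ c ]) is os → Here
    run-const {i} at = write-run i at refl

    -- The result is supplied with an equation, so memory is described by values such as `vertex u`
    -- and not by the arithmetic that produced them.
    run-add : ∀ {i j k x} → At (add i j k) → m j + m k ≡ x → x ≤ W →
              After (suc pc) (m [ i ≔ x ]) is os → Here
    run-add {i} at refl = write-run i at refl

    run-sub : ∀ {i j k x} → At (sub i j k) → m j ∸ m k ≡ x → x ≤ W →
              After (suc pc) (m [ i ≔ x ]) is os → Here
    run-sub {i} at refl = write-run i at refl

    run-load : ∀ {i j a x} → At (load i j) → m j ≡ a → m a ≡ x → x ≤ W →
               After (suc pc) (m [ i ≔ x ]) is os → Here
    run-load {i} at refl refl = write-run i at refl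

    run-store : ∀ {i j a x} → At (store i j) → m i ≡ a → m j ≡ x → x ≤ W →
                After (suc pc) (m [ a ≔ x ]) is os → Here
    run-store {i} at refl refl = write-run (m i) at refl

    run-print : ∀ {i x} → At (print i) → m i ≡ x → After (suc pc) m is (os ∷ʳ x) → Here
    run-print at refl = continue-run at refl

    run-halt : At halt → os ≡ out → Here
    run-halt at refl = 1 , stop (step-fetch (state pc m is os) at) , s≤s z≤n

    run-jump : ∀ {l j x} → At (jump-if>0 l j) → m j ≡ suc x → After l m is os → Here
    run-jump {l} {j} at eq = continue-run at taken
      where
      taken : execute W (jump-if>0 l j) (state pc m is os) ≡ continue (state l m is os)
      taken rewrite eq = refl

    run-skip : ∀ {l j} → At (jump-if>0 l j) → m j ≡ 0 → After (suc pc) m is os → Here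
    run-skip {l} {j} at eq = continue-run at skipped
      where
      skipped : execute W (jump-if>0 l j) (state pc m is os) ≡ continue (state (suc pc) m is os)
      skipped rewrite eq = refl

  run-read : ∀ {pc m i x is os b out} → head (drop pc P) ≡ just (read i) → x ≤ W →
             Runs (state (suc pc) (m [ i ≔ x ]) is os) b out →
             Runs (state pc m (x ∷ is) os) (suc b) out
  run-read {pc} {m} {i} {x} {is} {os} at x≤W (t , run , t≤b) =
    suc t , next (trans (step-fetch (state pc m (x ∷ is) os) at) written) run , s≤s t≤b
    where
    written : execute W (read i) (state pc m (x ∷ is) os) ≡
              continue (state (suc pc) (m [ i ≔ x ]) is os)
    written rewrite dec-true (x ≤? W) x≤W = refl

-- The machine program and its memory layout.

ONE N I A K U T : Address
ONE = 0
N   = 1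
I   = 2
A   = 3
K   = 4
U   = 5
T   = 6

-- Vertex k is represented by the address of its pointer; the next cell holds
-- its mark.  Cells below 7 are registers.
handle : ℕ → ℕ
handle k = 7 + 2 * k

outer inner finish advance output emit show-A show-U next-vertex : Label
outer       = 4
inner       = 9
finish      = 23
advance     = 30
output      = 33
emit        = 34
show-A      = 48
show-U      = 50
next-vertex = 51

-- `I` counts the vertices left to scan, `K` the neighbours left to read, and `N` in the output
-- phase the vertices left to print. `A` is the handle of the current vertex, `U` that of the last
-- neighbour read or of the stored partner (0 if there is none), and `T` is scratch. A jump on `ONE`
-- is unconditional.
program : Program
program =
    read N
  ∷ const ONE 1
  -- `T` is still 0, so this is a copy.
  ∷ add I T N
  ∷ const A (handle 0)
  -- outer:
  ∷ jump-if>0 6 I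
  ∷ jump-if>0 output ONE
  ∷ sub I I ONE
  ∷ read K
  ∷ const U 0
  -- inner:
  ∷ jump-if>0 11 K
  ∷ jump-if>0 finish ONE
  ∷ sub K K ONE
  ∷ read U
  -- Three instructions turn the index k just read into its handle 7 + 2k.
  ∷ add U U U
  ∷ const T (handle 0)
  ∷ add U T U
  ∷ load T A
  ∷ jump-if>0 inner T
  ∷ load T U
  ∷ jump-if>0 inner T
  ∷ store A U
  ∷ store U A
  ∷ jump-if>0 inner ONE
  -- finish:
  ∷ load T A
  ∷ jump-if>0 advance T
  -- `U` is 0 exactly when the list was empty; the isolated vertex then stays free.
  ∷ jump-if>0 27 U
  ∷ jump-if>0 advance ONE
  ∷ store A U
  ∷ add T U ONE
  ∷ store T ONE
  -- advance:
  ∷ add A A ONE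
  ∷ add A A ONE
  ∷ jump-if>0 outer ONE
  -- output:
  ∷ const A (handle 0)
  -- emit:
  ∷ jump-if>0 36 N
  ∷ halt
  ∷ sub N N ONE
  ∷ load U A
  ∷ jump-if>0 40 U
  -- Here `U` is 0, which is the output for an uncovered vertex.
  ∷ jump-if>0 show-U ONE
  ∷ add T A ONE
  ∷ load T T
  ∷ jump-if>0 show-A T
  ∷ add T U ONE
  ∷ load T T
  ∷ jump-if>0 show-U T
  -- Handles grow with the index, so the truncated difference is positive exactly when the partner
  -- has the smaller index.
  ∷ sub T A U
  ∷ jump-if>0 show-U T
  -- show-A:
  ∷ print A
  ∷ jump-if>0 next-vertex ONE
  -- show-U:
  ∷ print U
  -- next-vertex:
  ∷ add A A ONE
  ∷ add A A ONE
  ∷ jump-if>0 emit ONE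
  ∷ []

handle-injective : ∀ {i j} → handle i ≡ handle j → i ≡ j
handle-injective {i} {j} = ℕ.*-cancelˡ-≡ i j 2 ∘ ℕ.+-cancelˡ-≡ 7 (2 * i) (2 * j)

-- Parity keeps the pointer cells apart from the mark cells.
handle≢suc-handle : ∀ i j → handle i ≢ suc (handle j)
handle≢suc-handle i j = ℕ.even≢odd i j ∘ ℕ.+-cancelˡ-≡ 7 (2 * i) (suc (2 * j))
  ∘ λ eq → trans eq (sym (ℕ.+-suc 7 (2 * j)))

handle-double : ∀ k → handle 0 + (k + k) ≡ handle k
handle-double k = cong (λ x → 7 + (k + x)) (sym (ℕ.+-identityʳ k))

handle-suc : ∀ k → suc (suc (handle k)) ≡ handle (suc k)
handle-suc k = cong (7 +_) (sym (ℕ.*-suc 2 k))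

bit : Bool → ℕ
bit false = 0
bit true  = 1

-- Runs of consecutive vertices starting at index `k`. They tie the traversal of `allFin` to
-- register `A`, which moves one handle at a time.
data From {n : ℕ} : ℕ → List (Fin n) → Set where
  []  : ∀ {k} → From k []
  _∷_ : ∀ {k v vs} → k ≡ toℕ v → From (suc k) vs → From k (v ∷ vs)

from-tabulate : ∀ {m n} k (f : Fin m → Fin n) → (∀ i → k + toℕ i ≡ toℕ (f i)) →
                From k (tabulate f)
from-tabulate {zero}  k f eq = []
from-tabulate {suc m} k f eq =
  trans (sym (ℕ.+-identityʳ k)) (eq zero) ∷
  from-tabulate (suc k) (f ∘ suc) λ i → trans (sym (ℕ.+-suc k (toℕ i))) (eq (suc i))

module _ {n : ℕ} {st : Fin n → Status n} (v u : Fin n) where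

  visit-settled : ∀ {k x} → st v ≡ bound k x → visit v st u ≡ st
  visit-settled stv rewrite stv = refl

  visit-taken : ∀ {k x} → st v ≡ free → st u ≡ bound k x → visit v st u ≡ st
  visit-taken stv stu rewrite stv | stu = refl

  visit-free : st v ≡ free → st u ≡ free →
               visit v st u ≡ (st [ v ↦ bound matched u ]) [ u ↦ bound matched v ]
  visit-free stv stu rewrite stv | stu = refl

module _ {n : ℕ} {st : Fin n → Status n} {mk : Fin n → Bool} (v : Fin n) where

  attach-settled : ∀ {k x u?} → st v ≡ bound k x → attach v (config st mk) u? ≡ config st mk
  attach-settled stv rewrite stv = refl

  attach-isolated : st v ≡ free → attach v (config st mk) nothing ≡ config st mk
  attach-isolated stv rewrite stv = refl

  attach-free : ∀ {u} → st v ≡ free →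
    attach v (config st mk) (just u) ≡ config (st [ v ↦ bound attached u ]) (mk [ u ↦ true ])
  attach-free stv rewrite stv = refl

-- Simulation of the greedy algorithm by the program.

module Simulation {n : ℕ} (W : ℕ) (W-large : handle n ≤ W) where

  open Execution program W

  vertex : Fin n → ℕ
  vertex v = handle (toℕ v)

  -- Handles start at 7, so 0 is available for `free`, and a conditional jump on the pointer tests
  -- for it.
  pointer : Status n → ℕ
  pointer free        = 0
  pointer (bound _ u) = vertex u

  Stores : (Address → ℕ) → Config n → Set
  Stores m (config st mk) =
    (∀ v → m (vertex v) ≡ pointer (st v)) × (∀ v → m (suc (vertex v)) ≡ bit (mk v))

  store-status : ∀ m st mk v k u → Stores m (config st mk) →
                 Stores (m [ vertex v ≔ vertex u ]) (config (st [ v ↦ bound k u ]) mk)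
  store-status m st mk v k u (ptr , mrk) = ptr′ , λ w →
    trans (≔-other m (handle≢suc-handle (toℕ v) (toℕ w))) (mrk w)
    where
    ptr′ : ∀ w → (m [ vertex v ≔ vertex u ]) (vertex w) ≡ pointer ((st [ v ↦ bound k u ]) w)
    ptr′ w with w ≟ᶠ v
    ... | yes refl = trans (≔-same m (vertex v)) (cong pointer (sym (↦-same st v)))
    ... | no w≢v   =
      trans (≔-other m (w≢v ∘ sym ∘ toℕ-injective ∘ handle-injective))
            (trans (ptr w) (cong pointer (sym (↦-other st w≢v))))

  store-mark : ∀ m st mk u → Stores m (config st mk) →
               Stores (m [ suc (vertex u) ≔ 1 ]) (config st (mk [ u ↦ true ]))
  store-mark m st mk u (ptr , mrk) =
    (λ w → trans (≔-other m (≢-sym (handle≢suc-handle (toℕ w) (toℕ u)))) (ptr w)) , mrk′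
    where
    mrk′ : ∀ w → (m [ suc (vertex u) ≔ 1 ]) (suc (vertex w)) ≡ bit ((mk [ u ↦ true ]) w)
    mrk′ w with w ≟ᶠ u
    ... | yes refl = trans (≔-same m (suc (vertex u))) (cong bit (sym (↦-same mk u)))
    ... | no w≢u   =
      trans (≔-other m (w≢u ∘ sym ∘ toℕ-injective ∘ handle-injective ∘ ℕ.suc-injective))
            (trans (mrk w) (cong bit (sym (↦-other mk w≢u))))

  ≤W : ∀ {k} → k ≤ n → k ≤ W
  ≤W k≤n = ℕ.≤-trans k≤n (ℕ.≤-trans (ℕ.m≤n*m n 2) (ℕ.≤-trans (ℕ.m≤n+m (2 * n) 7) W-large))

  -- The case of `k` equal to `n` matters: after the last vertex, `A` still advances to `handle n`.
  handle≤W : ∀ {k} → k ≤ n → handle k ≤ W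
  handle≤W k≤n = ℕ.≤-trans (ℕ.+-monoʳ-≤ 7 (ℕ.*-monoʳ-≤ 2 k≤n)) W-large

  suc-handle≤W : ∀ {k} → k < n → suc (handle k) ≤ W
  suc-handle≤W {k} k<n = ℕ.≤-trans (ℕ.n≤1+n _)
    (ℕ.≤-trans (ℕ.≤-reflexive (handle-suc k)) (handle≤W k<n))

  vertex≤W : ∀ v → vertex v ≤ W
  vertex≤W v = handle≤W (ℕ.<⇒≤ (toℕ<n v))

  suc-vertex≤W : ∀ v → suc (vertex v) ≤ W
  suc-vertex≤W v = suc-handle≤W (toℕ<n v)

  pointer≤W : ∀ s → pointer s ≤ W
  pointer≤W free        = z≤n
  pointer≤W (bound _ u) = vertex≤W u

  1≤W : 1 ≤ W
  1≤W = ℕ.≤-trans (s≤s z≤n) W-large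

  bit≤W : ∀ b → bit b ≤ W
  bit≤W false = z≤n
  bit≤W true  = 1≤W

  handle0≤W : handle 0 ≤ W
  handle0≤W = handle≤W z≤n

  -- `K` and `U` change during the inner loop and are tracked by separate equations; `T` is scratch.
  Registers : (Address → ℕ) → ℕ → ℕ → Set
  Registers m i a = m ONE ≡ 1 × m N ≡ n × m I ≡ i × m A ≡ handle a

  last-read : Maybe (Fin n) → ℕ
  last-read = maybe vertex 0

  -- The longest path through the body, the one that matches two free vertices, takes 13 steps;
  -- leaving the loop takes 2. The rest of the run is a continuation that accepts any memory storing
  -- the updated configuration.
  run-inner : ∀ {v i st mk b out is os m} us u₀ → length us ≤ n →
    Registers m i (toℕ v) → Stores m (config st mk) →
    m K ≡ length us → m U ≡ last-read u₀ →
    (∀ {m′} → Registers m′ i (toℕ v) → Stores m′ (config (foldl (visit v) st us) mk) →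
              m′ U ≡ last-read (latest u₀ us) → Runs (state finish m′ is os) b out) →
    Runs (state inner m (map toℕ us ++ is) os) (length us * 13 + (2 + b)) out
  run-inner [] u₀ _ regs@(one , _) stores k≡ u≡ rest =
    run-skip refl k≡ (run-jump refl one (rest regs stores u≡))
  run-inner {v} {i} {st} {mk} {b} {out} {is} {os} {m} (u ∷ us) u₀ len
            (one , n≡ , i≡ , a≡) stores@(ptr , mrk) k≡ u≡ rest =
    run-jump refl k≡ (
    run-sub refl (cong₂ _∸_ k≡ one) (≤W len′) (
    run-read refl (≤W (ℕ.<⇒≤ (toℕ<n u))) (
    run-add refl refl (ℕ.≤-trans (ℕ.m≤n+m _ 7) handle-u≤W) (
    run-const refl handle0≤W (
    run-add refl (handle-double (toℕ u)) (vertex≤W u) (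
    run-load refl a≡ (ptr v) (pointer≤W (st v))
    (at-v (st v) (st u) refl refl)))))))
    where
    len′ : length us ≤ n
    len′ = ℕ.≤-trans (ℕ.n≤1+n _) len

    handle-u≤W : handle 0 + (toℕ u + toℕ u) ≤ W
    handle-u≤W = subst (_≤ W) (sym (handle-double (toℕ u))) (vertex≤W u)

    m₁ m₂ : Address → ℕ
    m₁ = ((((((m [ K ≔ length us ]) [ U ≔ toℕ u ]) [ U ≔ toℕ u + toℕ u ]) [ T ≔ handle 0 ])
         [ U ≔ vertex u ]) [ T ≔ pointer (st v) ])
    m₂ = m₁ [ T ≔ pointer (st u) ]

    budget = length us * 13 + (2 + b)

    recurse : ∀ {m′} st′ → Registers m′ i (toℕ v) → Stores m′ (config st′ mk) →
              m′ K ≡ length us → m′ U ≡ vertex u → visit v st u ≡ st′ →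
              Runs (state inner m′ (map toℕ us ++ is) os) budget out
    recurse _ regs stores k≡ u≡ refl = run-inner us (just u) len′ regs stores k≡ u≡ rest

    at-v : ∀ sv su → st v ≡ sv → st u ≡ su →
           Runs (state 17 m₁ (map toℕ us ++ is) os) (6 + budget) out
    -- The shorter branches are padded to the six steps of the matching branch.
    at-v (bound _ _) _ stv _ = weaken 5 (
      run-jump refl (cong pointer stv) (
      recurse st (one , n≡ , i≡ , a≡) stores refl refl (visit-settled v u stv)))
    at-v free (bound _ _) stv stu = weaken 3 (
      run-skip refl (cong pointer stv) (
      run-load refl refl (ptr u) (pointer≤W (st u)) (
      run-jump refl (cong pointer stu) (
      recurse st (one , n≡ , i≡ , a≡) stores refl refl (visit-taken v u stv stu)))))
    at-v free free stv stu =
      run-skip refl (cong pointer stv) (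
      run-load refl refl (ptr u) (pointer≤W (st u)) (
      run-skip refl (cong pointer stu) (
      run-store refl a≡ refl (vertex≤W u) (
      run-store refl refl a≡ (vertex≤W v) (
      run-jump refl one (
      recurse _ (one , n≡ , i≡ , a≡)
        (store-status (m₂ [ vertex v ≔ vertex u ]) (st [ v ↦ bound matched u ]) mk u matched v
          (store-status m₂ st mk v matched u stores))
        refl refl (visit-free v u stv stu)))))))

  -- The six steps are those of the attaching branch, the longest.
  run-finish : ∀ {v i st mk b out is os m} u? →
    Registers m i (toℕ v) → Stores m (config st mk) → m U ≡ last-read u? →
    (∀ {m′} → Registers m′ i (toℕ v) → Stores m′ (attach v (config st mk) u?) →
              Runs (state advance m′ is os) b out) →
    Runs (state finish m is os) (6 + b) out
  run-finish {v} {i} {st} {mk} {b} {out} {is} {os} {m} u?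
             (one , n≡ , i≡ , a≡) stores@(ptr , _) u≡ rest =
    run-load refl a≡ (ptr v) (pointer≤W (st v)) (cases (st v) refl u? u≡ rest′)
    where
    m₁ : Address → ℕ
    m₁ = m [ T ≔ pointer (st v) ]

    Continuation : Maybe (Fin n) → Set
    Continuation u? = ∀ {m′} c → Registers m′ i (toℕ v) → Stores m′ c →
      attach v (config st mk) u? ≡ c → Runs (state advance m′ is os) b out

    rest′ : Continuation u?
    rest′ _ regs stores refl = rest regs stores

    cases : ∀ sv → st v ≡ sv → ∀ u? → m U ≡ last-read u? → Continuation u? →
            Runs (state 24 m₁ is os) (5 + b) out
    cases (bound _ _) stv u? _ rest = weaken 4 (
      run-jump refl (cong pointer stv) (
      rest (config st mk) (one , n≡ , i≡ , a≡) stores (attach-settled v stv)))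
    cases free stv nothing u≡ rest = weaken 2 (
      run-skip refl (cong pointer stv) (
      run-skip refl u≡ (
      run-jump refl one (
      rest (config st mk) (one , n≡ , i≡ , a≡) stores (attach-isolated v stv)))))
    cases free stv (just u) u≡ rest =
      run-skip refl (cong pointer stv) (
      run-jump refl u≡ (
      run-store refl a≡ u≡ (vertex≤W u) (
      run-add refl (trans (cong₂ _+_ u≡ one) (ℕ.+-comm _ 1)) (suc-vertex≤W u) (
      run-store refl refl one 1≤W (
      rest _ (one , n≡ , i≡ , a≡)
        (store-mark (m₂ [ T ≔ suc (vertex u) ]) (st [ v ↦ bound attached u ]) mk u
          (store-status m₁ st mk v attached u stores))
        (attach-free v stv))))))
      where
      m₂ : Address → ℕ
      m₂ = m₁ [ vertex v ≔ vertex u ]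

  module _ (neighbours : Fin n → List (Fin n)) (short : ∀ v → length (neighbours v) ≤ n) where

    row : Fin n → List ℕ
    row v = length (neighbours v) ∷ map toℕ (neighbours v)

    -- Each vertex costs 4 steps before the inner loop, 13 per neighbour, and 11 = 2 + 6 + 3 for
    -- leaving that loop, `finish` and `advance`. The base case pays for leaving the outer loop.
    scanCost : List (Fin n) → ℕ
    scanCost []       = 2
    scanCost (v ∷ vs) = 4 + (length (neighbours v) * 13 + (11 + scanCost vs))

    run-scan : ∀ {b out os k m} vs c → From k vs → length vs ≤ n →
      Registers m (length vs) k → Stores m c →
      (∀ {m′ a} → Registers m′ 0 a → Stores m′ (scanAll neighbours c vs) →
                  Runs (state output m′ [] os) b out) →
      Runs (state outer m (concatMap row vs) os) (scanCost vs + b) out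
    run-scan {k = k} [] c [] _ regs@(one , _ , i≡ , _) stores rest =
      run-skip refl i≡ (run-jump refl one (rest {a = k} regs stores))
    run-scan {b} {out} {os} {m = m} (v ∷ vs) c (refl ∷ from) len (one , n≡ , i≡ , a≡) stores rest =
      run-jump refl i≡ (
      run-sub refl (cong₂ _∸_ i≡ one) (≤W len′) (
      run-read refl (≤W (short v)) (
      run-const refl z≤n (
      subst (λ b′ → Runs (state inner m₁ (map toℕ (neighbours v) ++ concatMap row vs) os) b′ out)
        (sym (ℕ.+-assoc (length (neighbours v) * 13) (11 + scanCost vs) b)) (
      run-inner {v} {st = Config.status c} {mk = Config.marked c}
        (neighbours v) nothing (short v) (one , n≡ , refl , a≡) stores refl refl
        λ regs₁ stores₁ u≡ →
      run-finish {v} {st = foldl (visit v) (Config.status c) (neighbours v)} {mk = Config.marked c}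
        (latest nothing (neighbours v)) regs₁ stores₁ u≡ λ (one₂ , n≡₂ , i≡₂ , a≡₂) stores₂ →
      run-add refl (trans (cong₂ _+_ a≡₂ one₂) (ℕ.+-comm _ 1)) (suc-vertex≤W v) (
      run-add refl (trans (cong (suc (vertex v) +_) one₂) (trans (ℕ.+-comm _ 1) (handle-suc (toℕ v))))
        (handle≤W (toℕ<n v)) (
      run-jump refl one₂ (
      run-scan vs (scan v (neighbours v) c) from len′ (one₂ , n≡₂ , i≡₂ , refl) stores₂
        λ {m′} {a} → rest {m′} {a}))))))))
      where
      len′ : length vs ≤ n
      len′ = ℕ.≤-trans (ℕ.n≤1+n _) len

      m₁ : Address → ℕ
      m₁ = ((m [ I ≔ length vs ]) [ K ≔ length (neighbours v) ]) [ U ≔ 0 ]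

  Emitting : (Address → ℕ) → ℕ → ℕ → Set
  Emitting m i a = m ONE ≡ 1 × m N ≡ i × m A ≡ handle a

  name : Config n → Fin n → ℕ
  name c v = maybe vertex 0 (center c v)

  -- The tests follow `partnerCenter`: own mark, partner's mark, then indices. The longest path has
  -- both ends unmarked and a zero difference, and takes 12 steps.
  run-show : ∀ {v i b out is os m} c → Emitting m i (toℕ v) → Stores m c →
    (∀ {m′} → Emitting m′ i (toℕ v) → Stores m′ c →
              Runs (state next-vertex m′ is (os ∷ʳ name c v)) b out) →
    Runs (state 37 m is os) (12 + b) out
  run-show {v} {i} {b} {out} {is} {os} {m} c@(config st mk) (one , n≡ , a≡) stores@(ptr , mrk) rest =
    run-load refl a≡ (ptr v) (pointer≤W (st v)) (cases (st v) refl)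
    where
    m₁ : Address → ℕ
    m₁ = m [ U ≔ pointer (st v) ]

    print-U : ∀ {m′ x} → Emitting m′ i (toℕ v) → Stores m′ c → m′ U ≡ x → name c v ≡ x →
              Runs (state show-U m′ is os) (suc b) out
    print-U emitting stores u≡ refl = run-print refl u≡ (rest emitting stores)

    print-A : ∀ {m′} → Emitting m′ i (toℕ v) → Stores m′ c → name c v ≡ vertex v →
              Runs (state show-A m′ is os) (2 + b) out
    print-A {m′} emitting@(one , _ , a≡) stores eq =
      run-print refl (trans a≡ (sym eq)) (run-jump refl one (rest emitting stores))

    module Bound {k u} (stv : st v ≡ bound k u) where

      name-marked : mk v ≡ true → name c v ≡ vertex v
      name-marked mkv rewrite stv | mkv = refl

      name-partner : mk v ≡ false → mk u ≡ true → name c v ≡ vertex u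
      name-partner mkv mku rewrite stv | mkv | mku = refl

      name-< : mk v ≡ false → mk u ≡ false → toℕ u < toℕ v → name c v ≡ vertex u
      name-< mkv mku u<v rewrite stv | mkv | mku with u <? v
      ... | yes _  = refl
      ... | no u≮v = contradiction u<v u≮v

      name-≮ : mk v ≡ false → mk u ≡ false → ¬ toℕ u < toℕ v → name c v ≡ vertex v
      name-≮ mkv mku u≮v rewrite stv | mkv | mku with u <? v
      ... | yes u<v = contradiction u<v u≮v
      ... | no _    = refl

      Ready : (Address → ℕ) → ℕ → Set
      Ready m′ t = Emitting m′ i (toℕ v) × Stores m′ c × m′ U ≡ vertex u × m′ T ≡ t

      compare : ∀ {m′} d → mk v ≡ false → mk u ≡ false → vertex v ∸ vertex u ≡ d → Ready m′ d →
                Runs (state 47 m′ is os) (3 + b) out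
      compare zero mkv mku eq (emitting , stores , u≡ , t≡) =
        run-skip refl t≡ (
        print-A emitting stores (name-≮ mkv mku λ u<v →
          ℕ.<⇒≱ (ℕ.+-monoʳ-< 7 (ℕ.*-monoʳ-< 2 u<v)) (ℕ.m∸n≡0⇒m≤n {vertex v} eq)))
      compare (suc d) mkv mku eq (emitting , stores , u≡ , t≡) = weaken 1 (
        run-jump refl t≡ (
        print-U emitting stores u≡ (name-< mkv mku (ℕ.≰⇒> λ v≤u →
          contradiction (trans (sym eq) (ℕ.m≤n⇒m∸n≡0 (ℕ.+-monoʳ-≤ 7 (ℕ.*-monoʳ-≤ 2 v≤u)))) λ ()))))

      partner-mark : ∀ {m′} bu → mk v ≡ false → mk u ≡ bu → Ready m′ (bit bu) →
                     Runs (state 45 m′ is os) (5 + b) out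
      partner-mark true mkv mku (emitting , stores , u≡ , t≡) = weaken 3 (
        run-jump refl t≡ (
        print-U emitting stores u≡ (name-partner mkv mku)))
      partner-mark false mkv mku (emitting@(one , n≡ , a≡) , stores , u≡ , t≡) =
        run-skip refl t≡ (
        run-sub refl (cong₂ _∸_ a≡ u≡) (ℕ.≤-trans (ℕ.m∸n≤m (vertex v) (vertex u)) (vertex≤W v)) (
        compare (vertex v ∸ vertex u) mkv mku refl (emitting , stores , u≡ , refl)))

      own-mark : ∀ {m′} bv → mk v ≡ bv → Ready m′ (bit bv) →
                 Runs (state 42 m′ is os) (8 + b) out
      own-mark true mkv (emitting , stores , u≡ , t≡) = weaken 5 (
        run-jump refl t≡ (
        print-A emitting stores (name-marked mkv)))
      own-mark false mkv (emitting@(one , n≡ , a≡) , stores@(_ , mrk) , u≡ , t≡) =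
        run-skip refl t≡ (
        run-add refl (trans (cong₂ _+_ u≡ one) (ℕ.+-comm _ 1)) (suc-vertex≤W u) (
        run-load refl refl (mrk u) (bit≤W (mk u)) (
        partner-mark (mk u) mkv refl (emitting , stores , u≡ , refl))))

    name-free : st v ≡ free → name c v ≡ 0
    name-free stv rewrite stv = refl

    cases : ∀ sv → st v ≡ sv → Runs (state 38 m₁ is os) (11 + b) out
    cases free stv = weaken 8 (
      run-skip refl (cong pointer stv) (
      run-jump refl one (
      print-U (one , n≡ , a≡) stores (cong pointer stv) (name-free stv))))
    cases (bound _ _) stv =
      run-jump refl (cong pointer stv) (
      run-add refl (trans (cong₂ _+_ a≡ one) (ℕ.+-comm _ 1)) (suc-vertex≤W v) (
      run-load refl refl (mrk v) (bit≤W (mk v)) (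
      Bound.own-mark stv (mk v) refl ((one , n≡ , a≡) , stores , cong pointer stv , refl))))

  -- One round takes 17 = 2 + 12 + 3 steps, and the end of the loop with `halt` takes 2. The
  -- accumulated `os` enters through an equation, so `out` is fixed along the recursion.
  run-emit : ∀ {k out is m} vs os c → From k vs → length vs ≤ n →
    Emitting m (length vs) k → Stores m c → os ++ map (name c) vs ≡ out →
    Runs (state emit m is os) (length vs * 17 + 2) out
  run-emit [] os c [] _ (_ , n≡ , _) stores eq =
    run-skip refl n≡ (run-halt refl (trans (sym (++-identityʳ os)) eq))
  run-emit (v ∷ vs) os c (refl ∷ from) len (one , n≡ , a≡) stores eq =
    run-jump refl n≡ (
    run-sub refl (cong₂ _∸_ n≡ one) (≤W len′) (
    run-show {v} c (one , refl , a≡) stores λ (one₁ , n≡₁ , a≡₁) stores₁ →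
    run-add refl (trans (cong₂ _+_ a≡₁ one₁) (ℕ.+-comm _ 1)) (suc-vertex≤W v) (
    run-add refl (trans (cong (suc (vertex v) +_) one₁) (trans (ℕ.+-comm _ 1) (handle-suc (toℕ v))))
      (handle≤W (toℕ<n v)) (
    run-jump refl one₁ (
    run-emit vs (os ∷ʳ name c v) c from len′ (one₁ , n≡₁ , refl) stores₁
      (trans (++-assoc os (name c v ∷ []) (map (name c) vs)) eq))))))
    where
    len′ : length vs ≤ n
    len′ = ℕ.≤-trans (ℕ.n≤1+n _) len

  run-program : (neighbours : Fin n → List (Fin n)) (short : ∀ v → length (neighbours v) ≤ n) →
    let vs = allFin n in
    Runs (initial (n ∷ concatMap (row neighbours short) vs))
         (4 + (scanCost neighbours short vs + (1 + (length vs * 17 + 2))))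
         (tabulate (name (scanAll neighbours unscanned vs)))
  run-program neighbours short =
    run-read refl (≤W ℕ.≤-refl) (
    run-const refl 1≤W (
    run-add refl refl (≤W ℕ.≤-refl) (
    run-const refl handle0≤W (
    run-scan neighbours short vs unscanned from (ℕ.≤-reflexive len)
      -- All cells above the registers are still 0, which encodes `unscanned`.
      (refl , refl , sym len , refl) ((λ _ → refl) , λ _ → refl) λ (one , n≡ , _) stores →
    run-const refl handle0≤W (
    run-emit vs [] c from (ℕ.≤-reflexive len) (one , trans n≡ (sym len) , refl) stores
      (map-tabulate (λ v → v) (name c)))))))
    where
    vs = allFin n
    c  = scanAll neighbours unscanned vs
    from : From 0 vs
    from = from-tabulate 0 (λ v → v) λ _ → refl
    len : length vs ≡ n
    len = length-tabulate (λ v → v)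

-- Counting darts

lookup-injective : ∀ {A : Set} {xs : List A} → Unique xs → ∀ {i j} →
                   lookup xs i ≡ lookup xs j → i ≡ j
lookup-injective (_   ∷ _)   {zero}  {zero}  eq = refl
lookup-injective (x∉  ∷ _)   {zero}  {suc j} eq = contradiction eq (All.lookup x∉ (∈-lookup j))
lookup-injective (x∉  ∷ _)   {suc i} {zero}  eq = contradiction (sym eq) (All.lookup x∉ (∈-lookup i))
lookup-injective (_   ∷ xs!) {suc i} {suc j} eq = cong suc (lookup-injective xs! eq)

-- Pigeonhole: sending each entry to a position where it occurs in `ys` is injective, because `xs`
-- has no repetitions.
unique-⊆⇒≤ : ∀ {A : Set} {xs ys : List A} → Unique xs → xs ⊆ˡ ys → length xs ≤ length ys
unique-⊆⇒≤ {xs = xs} {ys} xs! xs⊆ys = injective⇒≤ {f = position} λ {i} {j} eq →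
  lookup-injective xs! (trans (lookup-index (xs⊆ys (∈-lookup i)))
                       (trans (cong (lookup ys) eq) (sym (lookup-index (xs⊆ys (∈-lookup j))))))
  where
  position : Fin (length xs) → Fin (length ys)
  position i = index (xs⊆ys (∈-lookup i))

module _ {n : ℕ} {G : Graph (Fin n)} (L : AdjacencyLists G) where
  open AdjacencyLists L

  -- Ensures that the degrees read from the input fit into a machine word.
  short : ∀ v → length (neighbours v) ≤ n
  short v = subst (length (neighbours v) ≤_) (length-tabulate (λ u → u))
    (unique-⊆⇒≤ (unique v) λ {u} _ → ∈-allFin u)

  -- Darts are oriented edges, one per adjacency-list entry, so their number is the sum of the
  -- degrees.
  dartsAt : Fin n → List (Fin n × Fin n)
  dartsAt v = map (v ,_) (neighbours v)

  darts : List (Fin n) → List (Fin n × Fin n)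
  darts = concatMap dartsAt

  darts-unique : Unique (darts (allFin n))
  darts-unique = Unique.concat⁺
    (All.map⁺ (All.tabulate⁺ λ v → Unique.map⁺ (cong proj₂) (unique v)))
    (AllPairs.map⁺ (AllPairs.map disjoint (Unique.allFin⁺ n)))
    where
    disjoint : ∀ {u v} → _ → ∀ {e} → e ∈ˡ dartsAt u × e ∈ˡ dartsAt v → _
    disjoint u≢v (e∈u , e∈v) with _ , _ , refl ← ∈-map⁻ _ e∈u | _ , _ , refl ← ∈-map⁻ _ e∈v =
      u≢v refl

  -- `edges` lists only increasing pairs, so a decreasing dart is found among the swapped ones. The
  -- inclusion gives the inequality half of the handshake lemma.
  darts⊆edges : darts (allFin n) ⊆ˡ edges G ++ map swap (edges G)
  darts⊆edges {u , v} e∈ with _ , e∈at , at∈ ← ∈-concat⁻′ (map dartsAt (allFin n)) e∈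
    with w , _ , refl ← ∈-map⁻ dartsAt at∈
    with _ , v∈ , refl ← ∈-map⁻ (w ,_) e∈at
    with u~v ← Equivalence.to (correct u v) v∈
    with <-cmp u v
  ... | tri< u<v _ _ = ∈-++⁺ˡ
    (∈-filter⁺ _ (∈-cartesianProduct⁺ (∈-allFin u) (∈-allFin v)) (u<v , u~v))
  ... | tri≈ _ refl _ = contradiction u~v (~-irr G)
  ... | tri> _ _ v<u = ∈-++⁺ʳ (edges G) (∈-map⁺ swap
    (∈-filter⁺ _ (∈-cartesianProduct⁺ (∈-allFin v) (∈-allFin u)) (v<u , ~-sym G u~v)))

  handshake : length (darts (allFin n)) ≤ ∣E G ∣ + ∣E G ∣
  handshake = subst (length (darts (allFin n)) ≤_)
    (trans (length-++ (edges G)) (cong (∣E G ∣ +_) (length-map swap (edges G))))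
    (unique-⊆⇒≤ darts-unique darts⊆edges)

-- Word bound and total running time.

handle≤word : ∀ n e → handle n ≤ (2 + n + e) ^ 3
handle≤word n e = begin
  -- The slack completes the left side to four times the base, and 4 is at most the base squared.
  -- The empty graph forces the exponent 3: there the base is 2, and 7 exceeds its square.
  7 + 2 * n                              ≤⟨ ℕ.m≤m+n _ (1 + 2 * n + 4 * e) ⟩
  7 + 2 * n + (1 + 2 * n + 4 * e)        ≡⟨ regroup n e ⟩
  (2 + n + e) * 2 ^ 2                    ≤⟨ ℕ.*-monoʳ-≤ (2 + n + e)
                                              (ℕ.^-monoˡ-≤ 2 (ℕ.m≤m+n 2 (n + e))) ⟩
  (2 + n + e) * (2 + n + e) ^ 2          ∎
  where
  open ℕ.≤-Reasoning
  regroup : ∀ n e → 7 + 2 * n + (1 + 2 * n + 4 * e) ≡ (2 + n + e) * 4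
  regroup = solve-∀

module _ {n : ℕ} {G : Graph (Fin n)} (L : AdjacencyLists G) where
  open AdjacencyLists L

  private
    m = ∣E G ∣
    module S = Simulation {n} ((2 + n + m) ^ 3) (handle≤word n m)

  -- The fixed costs 4 and 11 give 15 per vertex, and each dart is read once at cost 13.
  scanCost-darts : ∀ vs → S.scanCost neighbours (short L) vs ≡
                   2 + (length vs * 15 + length (darts L vs) * 13)
  scanCost-darts []       = refl
  scanCost-darts (v ∷ vs) = trans
    (cong (λ x → 4 + (length (neighbours v) * 13 + (11 + x))) (scanCost-darts vs))
    (trans (regroup (length (neighbours v)) (length vs) (length (darts L vs)))
           (cong (λ x → 2 + ((1 + length vs) * 15 + x * 13)) (sym length-darts)))
    where
    regroup : ∀ d l e → 4 + (d * 13 + (11 + (2 + (l * 15 + e * 13)))) ≡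
              2 + ((1 + l) * 15 + (d + e) * 13)
    regroup = solve-∀

    length-darts : length (darts L (v ∷ vs)) ≡ length (neighbours v) + length (darts L vs)
    length-darts = trans (length-++ (dartsAt L v))
      (cong (_+ length (darts L vs)) (length-map (v ,_) (neighbours v)))

  -- The budget is at most 9 + 32n + 26m: scanning and printing take 15 + 17 per vertex, and each
  -- edge has two darts at 13 each. Hence the factor 32.
  time-bound : 4 + (S.scanCost neighbours (short L) (allFin n) + (1 + (length (allFin n) * 17 + 2)))
               ≤ 32 * (1 + n + m)
  time-bound = begin
    4 + (S.scanCost neighbours (short L) (allFin n) + (1 + (length (allFin n) * 17 + 2)))
      ≡⟨ cong (λ x → 4 + (x + (1 + (length (allFin n) * 17 + 2)))) (scanCost-darts (allFin n)) ⟩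
    4 + (2 + (length (allFin n) * 15 + d * 13) + (1 + (length (allFin n) * 17 + 2)))
      ≡⟨ cong (λ x → 4 + (2 + (x * 15 + d * 13) + (1 + (x * 17 + 2))))
            (length-tabulate {n = n} (λ v → v)) ⟩
    4 + (2 + (n * 15 + d * 13) + (1 + (n * 17 + 2)))
      ≤⟨ ℕ.+-monoʳ-≤ 4 (ℕ.+-monoˡ-≤ (1 + (n * 17 + 2)) (ℕ.+-monoʳ-≤ 2
           (ℕ.+-monoʳ-≤ (n * 15) (ℕ.*-monoˡ-≤ 13 (handshake L))))) ⟩
    4 + (2 + (n * 15 + (m + m) * 13) + (1 + (n * 17 + 2)))
      ≤⟨ ℕ.m≤m+n _ (23 + 6 * m) ⟩
    4 + (2 + (n * 15 + (m + m) * 13) + (1 + (n * 17 + 2))) + (23 + 6 * m)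
      ≡⟨ regroup n m ⟩
    32 * (1 + n + m) ∎
    where
    open ℕ.≤-Reasoning
    d = length (darts L (allFin n))
    regroup : ∀ n m → 4 + (2 + (n * 15 + (m + m) * 13) + (1 + (n * 17 + 2))) + (23 + 6 * m) ≡
              32 * (1 + n + m)
    regroup = solve-∀

theorem5 : SolvableInLinearTime (MaximumDisjointClubCovering 2 2)
theorem5 = program , 32 , 3 , λ n G L →
  let open AdjacencyLists L
      open Simulation {n} ((2 + n + ∣E G ∣) ^ 3) (handle≤word n ∣E G ∣)
      partition = scanAll-partition G L
      t , run , t≤ = run-program neighbours (short L)
  in t , _ , stars G partition , run , ℕ.≤-trans t≤ (time-bound L) ,
     stars-encoded G partition vertex (λ ()) (λ eq → toℕ-injective (handle-injective eq)) ,
     stars-maximum G partition
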